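{- Let $m \geq 1$ be an integer. Let $G$ be an edge-colored complete graph on $n \geq 9m+8$ vertices. If $$c(G) > mn - \binom{m+1}{2},$$ then $G$ contains a proper $mK_3$.
   Context: All graphs are finite and simple. An edge-colored graph is a graph $G$ together with an arbitrary map $C:E(G)\to\mathbb{N}$ (not necessarily a proper coloring). $c(G)=|C(E(G))|$ is the number of distinct colors appearing on the edges of $G$. An edge-colored graph is rainbow if no two of its edges share the same color. A proper $mK_3$ is a union of $m$ pairwise vertex-disjoint rainbow triangles (each triangle is rainbow; different triangles may share colors). -}

module Defs where

open import Data.Nat using (ℕ)
import Data.Nat as ℕ
open import Data.Fin using (Fin; zero; suc; _<?_)
open import Data.List using (List; []; _∷_; map; filter; length; allFin; cartesianProduct; deduplicate)
open import Data.List.Relation.Unary.Unique.Propositional using (Unique)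
open import Data.Product using (_×_; _,_; proj₁; proj₂; uncurry; Σ-syntax)
open import Level using (0ℓ)
open import Relation.Binary using (Rel; Decidable; Symmetric; Irreflexive)
open import Relation.Binary.PropositionalEquality using (_≡_; _≢_)

record Graph (n : ℕ) : Set₁ where
  field
    Adj        : Rel (Fin n) 0ℓ
    adj?       : Decidable Adj
    adj-sym    : Symmetric Adj
    adj-irrefl : Irreflexive _≡_ Adj

  -- Each edge is listed exactly once, as its pair of ends in increasing order.
  edges : List (Fin n × Fin n)
  edges = filter (λ e → adj? (proj₁ e) (proj₂ e))
            (filter (λ e → proj₁ e <? proj₂ e)
              (cartesianProduct (allFin n) (allFin n)))

-- The colour of an edge uv is colour u v; symmetry makes it a function of the
-- unordered pair. Values of colour at non-adjacent pairs are never used.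
record EdgeColouredGraph (n : ℕ) : Set₁ where
  field
    graph      : Graph n
    colour     : Fin n → Fin n → ℕ
    colour-sym : ∀ u v → colour u v ≡ colour v u

  open Graph graph public

module _ {n : ℕ} (G : EdgeColouredGraph n) where
  open EdgeColouredGraph G

  Complete : Set
  Complete = ∀ u v → u ≢ v → Adj u v

  c : ℕ
  c = length (deduplicate ℕ._≟_ (map (uncurry colour) edges))

  -- Rainbowness of the subgraph whose edges are listed, without repetition, in es.
  Rainbow : List (Fin n × Fin n) → Set
  Rainbow es = Unique (map (uncurry colour) es)

  -- The three vertices are distinct because Adj is irreflexive.
  record Triangle : Set where
    field
      vertex   : Fin 3 → Fin n
      adjacent : ∀ p q → p ≢ q → Adj (vertex p) (vertex q)

  open Triangle

  triangleEdges : Triangle → List (Fin n × Fin n)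
  triangleEdges T = (x , y) ∷ (y , z) ∷ (x , z) ∷ []
    where
    x = vertex T zero
    y = vertex T (suc zero)
    z = vertex T (suc (suc zero))

  VertexDisjoint : Triangle → Triangle → Set
  VertexDisjoint S T = ∀ p q → vertex S p ≢ vertex T q

  ContainsPropermK₃ : ℕ → Set
  ContainsPropermK₃ m =
    Σ[ T ∈ (Fin m → Triangle) ]
      (∀ i → Rainbow (triangleEdges (T i))) ×
      (∀ i j → i ≢ j → VertexDisjoint (T i) (T j))

{-# OPTIONS --safe #-}

-- Induction on the number k of triangles. Deleting any vertex x costs at most n − 1 colours, so
-- G − x satisfies the bound for k and has k disjoint rainbow triangles. Fix such a packing, with
-- vertex set T, and let R be the other vertices. If xy and xz have distinct colours new to R, for
-- y, z in R, then xyz is rainbow. Hence k + 1 triangles are found when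
--   * some x in T sends at least 3 k + 2 new colours to R: repack G − x with k triangles, which
--     leave two of these colours unobstructed;
--   * two vertices of one triangle each send at least 5 new colours to R: replace that triangle
--     by two;
--   * R contains a rainbow triangle.
-- Otherwise R has fewer than |R| colours (Gallai: a vertex with two colours new to the others lies
-- in a rainbow triangle, so deleting vertices one by one loses at most one colour each time), every
-- triangle adds few new colours, and at most 9 k² / 2 occur inside T: too few in total.
module Submission where

open import Defs
import Data.Nat as ℕ
open import Data.Nat using (ℕ; zero; suc; _+_; _*_; _∸_; _≤_; _<_; _≥_; _>_; _≤?_; _<?_; z≤n; s≤s)
open import Data.Nat.Combinatorics using (_C_; nC1≡n; nCk+nC[k+1]≡[n+1]C[k+1])
open import Data.Nat.Properties
open import Data.Nat.Tactic.RingSolver using (solve-∀)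
open import Data.Empty using (⊥; ⊥-elim)
open import Data.Fin using (Fin; zero; suc)
import Data.Fin.Properties as Fin
open import Data.List using (List; []; _∷_; _++_; map; filter; length; lookup; allFin; concatMap; deduplicate; cartesianProduct)
open import Data.List.Properties using (length-++; length-map; length-tabulate; concatMap-++)
open import Data.List.Membership.Propositional using (_∈_; _∉_; find)
open import Data.List.Membership.Propositional.Properties
import Data.List.Membership.DecPropositional as DecMembership
open import Data.List.Relation.Binary.Disjoint.Propositional using (Disjoint)
open import Data.List.Relation.Binary.Subset.Propositional using (_⊆_)
open import Data.List.Relation.Unary.All as All using (All; []; _∷_)
open import Data.List.Relation.Unary.All.Properties using (¬Any⇒All¬; ++⁻ˡ; ++⁻ʳ)
open import Data.List.Relation.Unary.AllPairs using ([]; _∷_)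
open import Data.List.Relation.Unary.Any as Any using (Any; here; there; any?)
open import Data.List.Relation.Unary.Unique.Propositional using (Unique)
import Data.List.Relation.Unary.Unique.Propositional.Properties as Unique
open import Data.List.Relation.Unary.Unique.DecPropositional.Properties using (deduplicate-!)
open import Data.Product using (_×_; _,_; proj₁; proj₂; uncurry; ∃; ∃₂)
open import Data.Sum using (_⊎_; inj₁; inj₂)
open import Function using (_∘_; id)
open import Relation.Binary.Definitions using (DecidableEquality)
open import Relation.Binary.PropositionalEquality
open import Relation.Nullary using (¬_; Dec; yes; no; ¬?; contradiction; _×-dec_; _⊎-dec_)

-- Counting with duplicate-free lists.

-- Pigeonhole: strike one occurrence of `x` out of `ys`; as `x` does not recur in the tail of `xs`,
-- that tail still lies in what is left.
unique-⊆⇒length-≤ : {A : Set} {xs ys : List A} → Unique xs → xs ⊆ ys → length xs ≤ length ys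
unique-⊆⇒length-≤ []                     _     = z≤n
unique-⊆⇒length-≤ {xs = x ∷ xs} (x∉ ∷ u) xs⊆ys with ∈-∃++ (xs⊆ys (here refl))
... | as , bs , refl = begin
  suc (length xs)             ≤⟨ s≤s (unique-⊆⇒length-≤ u xs⊆as++bs) ⟩
  suc (length (as ++ bs))     ≡⟨ cong suc (length-++ as) ⟩
  suc (length as + length bs) ≡⟨ +-suc (length as) (length bs) ⟨
  length as + suc (length bs) ≡⟨ length-++ as ⟨
  length (as ++ x ∷ bs)       ∎
  where
  open ≤-Reasoning
  xs⊆as++bs : xs ⊆ as ++ bs
  xs⊆as++bs v∈xs with ∈-++⁻ as (xs⊆ys (there v∈xs))
  ... | inj₁ v∈as         = ∈-++⁺ˡ v∈as
  ... | inj₂ (here refl)  = ⊥-elim (All.lookup x∉ v∈xs refl)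
  ... | inj₂ (there v∈bs) = ∈-++⁺ʳ as v∈bs

∉⇒unique-∷ : {A : Set} {x : A} {xs : List A} → x ∉ xs → Unique xs → Unique (x ∷ xs)
∉⇒unique-∷ x∉xs u = ¬Any⇒All¬ _ x∉xs ∷ u

unique⇒lookup-injective : {A : Set} {xs : List A} → Unique xs → ∀ i j → lookup xs i ≡ lookup xs j → i ≡ j
unique⇒lookup-injective (_ ∷ _)  zero    zero    _  = refl
unique⇒lookup-injective (x∉ ∷ _) zero    (suc j) eq = ⊥-elim (All.lookup x∉ (∈-lookup j) eq)
unique⇒lookup-injective (x∉ ∷ _) (suc i) zero    eq = ⊥-elim (All.lookup x∉ (∈-lookup i) (sym eq))
unique⇒lookup-injective (_ ∷ u)  (suc i) (suc j) eq = cong suc (unique⇒lookup-injective u i j eq)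

module _ {A : Set} (_≟_ : DecidableEquality A) where
  open DecMembership _≟_ using (_∈?_)

  difference : List A → List A → List A
  difference xs ys = filter (λ x → ¬? (x ∈? ys)) xs

  ∈-difference⁺ : ∀ {x xs ys} → x ∈ xs → x ∉ ys → x ∈ difference xs ys
  ∈-difference⁺ {ys = ys} = ∈-filter⁺ (λ x → ¬? (x ∈? ys))

  ∈-difference⁻ : ∀ {x xs ys} → x ∈ difference xs ys → x ∈ xs × x ∉ ys
  ∈-difference⁻ {ys = ys} = ∈-filter⁻ (λ x → ¬? (x ∈? ys))

  difference-unique : ∀ {xs} ys → Unique xs → Unique (difference xs ys)
  difference-unique ys = Unique.filter⁺ (λ x → ¬? (x ∈? ys))

  ⊆-difference : ∀ xs ys → xs ⊆ ys ++ difference xs ys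
  ⊆-difference xs ys {x} x∈xs with x ∈? ys
  ... | yes x∈ys = ∈-++⁺ˡ x∈ys
  ... | no  x∉ys = ∈-++⁺ʳ ys (∈-difference⁺ x∈xs x∉ys)

  -- The list `ys` can strike out at most `length ys` of the distinct entries of `xs`, so two
  -- survive in the difference.
  two-outside : ∀ {xs} ys → Unique xs → 2 + length ys ≤ length xs →
    ∃₂ λ a b → a ≢ b × (a ∈ xs × a ∉ ys) × (b ∈ xs × b ∉ ys)
  two-outside {xs} ys u 2+ys≤xs = go (difference-unique ys u) ∈-difference⁻
      (+-cancelʳ-≤ (length ys) 2 _ (begin
        2 + length ys                           ≤⟨ 2+ys≤xs ⟩
        length xs                               ≤⟨ unique-⊆⇒length-≤ u (⊆-difference xs ys) ⟩
        length (ys ++ difference xs ys)         ≡⟨ length-++ ys ⟩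
        length ys + length (difference xs ys)   ≡⟨ +-comm (length ys) _ ⟩
        length (difference xs ys) + length ys   ∎))
    where
    open ≤-Reasoning
    go : ∀ {ds} → Unique ds → (∀ {x} → x ∈ ds → x ∈ xs × x ∉ ys) → 2 ≤ length ds →
      ∃₂ λ a b → a ≢ b × (a ∈ xs × a ∉ ys) × (b ∈ xs × b ∉ ys)
    go {a ∷ b ∷ _} ((a≢b ∷ _) ∷ _) out _ = a , b , a≢b , out (here refl) , out (there (here refl))
    go {_ ∷ []} _ _ (s≤s ())

-- Binomial coefficients and the final count.

pascal : ∀ k → suc (suc k) C 2 ≡ suc k + suc k C 2
pascal k = trans (sym (nCk+nC[k+1]≡[n+1]C[k+1] (suc k) 1)) (cong (_+ suc k C 2) (nC1≡n (suc k)))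

2*[1+k]C2≡k*[1+k] : ∀ k → 2 * (suc k C 2) ≡ k * suc k
2*[1+k]C2≡k*[1+k] zero    = refl
2*[1+k]C2≡k*[1+k] (suc k) = begin
  2 * (suc (suc k) C 2)        ≡⟨ cong (2 *_) (pascal k) ⟩
  2 * (suc k + suc k C 2)      ≡⟨ *-distribˡ-+ 2 (suc k) (suc k C 2) ⟩
  2 * suc k + 2 * (suc k C 2)  ≡⟨ cong (2 * suc k +_) (2*[1+k]C2≡k*[1+k] k) ⟩
  2 * suc k + k * suc k        ≡⟨ *-distribʳ-+ (suc k) 2 k ⟨
  suc (suc k) * suc k          ≡⟨ *-comm (suc (suc k)) (suc k) ⟩
  suc k * suc (suc k)          ∎
  where open ≡-Reasoning

-- With n vertices of which 3 k are covered by k triangles, c, d, q, cR count the colours of the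
-- whole, those new at the covered vertices, those inside them, and those of the r others.
colour-count-contradiction : ∀ {k n c d q cR r} → 9 * suc k + 8 ≤ n →
  suc k * n < c + suc (suc k) C 2 → c ≤ d + (q + cR) →
  d ≤ k * (3 * k + 4 + 8) → 2 * q ≤ (k * 3) * (k * 3) → cR < r → k * 3 + r ≤ n → ⊥
colour-count-contradiction {k} {n} {c} {d} {q} {cR} {r} large many c≤ d≤ q≤ cR< r≤ = <-irrefl refl (begin-strict
  bound                                                <⟨ m<m+n bound (s≤s z≤n) ⟩
  -- All terms are doubled to avoid halves. The slack is chosen so that `2 * k` copies of the lower
  -- bound on `n` appear, which `large` then replaces by `n`.
  bound + (2 + (2 * (k * k) + 13 * k))                 ≡⟨ eq₁ k n ⟩
  2 * n + 2 * k * (9 * suc k + 8) + (6 * k + 4)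
    ≤⟨ +-monoˡ-≤ (6 * k + 4) (+-monoʳ-≤ (2 * n) (*-monoʳ-≤ (2 * k) large)) ⟩
  2 * n + 2 * k * n + (6 * k + 4)                      ≡⟨ eq₂ k n ⟩
  -- The summand `2 * (1 + k * 3)` is kept to complete `cR` to `k * 3 + suc cR`, which is at most
  -- `n`.
  2 * suc (suc k * n) + 2 * (1 + k * 3)                ≤⟨ +-monoˡ-≤ _ (*-monoʳ-≤ 2 many) ⟩
  2 * (c + t) + 2 * (1 + k * 3)                        ≤⟨ +-monoˡ-≤ _ (*-monoʳ-≤ 2 (+-monoˡ-≤ t c≤)) ⟩
  2 * (d + (q + cR) + t) + 2 * (1 + k * 3)             ≡⟨ eq₃ k d q cR t ⟩
  2 * d + 2 * q + 2 * t + 2 * (k * 3 + suc cR)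
    ≤⟨ +-mono-≤ (+-mono-≤ (+-mono-≤ (*-monoʳ-≤ 2 d≤) q≤) (≤-reflexive (2*[1+k]C2≡k*[1+k] (suc k))))
                (*-monoʳ-≤ 2 (≤-trans (+-monoʳ-≤ (k * 3) cR<) r≤)) ⟩
  bound                                                ∎)
  where
  open ≤-Reasoning
  t = suc (suc k) C 2
  bound = 2 * (k * (3 * k + 4 + 8)) + k * 3 * (k * 3) + suc k * suc (suc k) + 2 * n
  eq₁ : ∀ k n → 2 * (k * (3 * k + 4 + 8)) + k * 3 * (k * 3) + suc k * suc (suc k) + 2 * n + (2 + (2 * (k * k) + 13 * k))
      ≡ 2 * n + 2 * k * (9 * suc k + 8) + (6 * k + 4)
  eq₁ = solve-∀
  eq₂ : ∀ k n → 2 * n + 2 * k * n + (6 * k + 4) ≡ 2 * suc (suc k * n) + 2 * (1 + k * 3)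
  eq₂ = solve-∀
  eq₃ : ∀ k d q cR t → 2 * (d + (q + cR) + t) + 2 * (1 + k * 3) ≡ 2 * d + 2 * q + 2 * t + 2 * (k * 3 + suc cR)
  eq₃ = solve-∀

-- Colours spanned by a list of vertices.

module Colouring {V : Set} (_≟_ : DecidableEquality V)
  (colour : V → V → ℕ) (colour-sym : ∀ u v → colour u v ≡ colour v u) where

  open DecMembership ℕ._≟_ using (_∈?_)

  _∖_ : List V → List V → List V
  _∖_ = difference _≟_

  -- A duplicate-free list of vertices stands for the complete graph that it spans, so that deleting
  -- vertices requires no new graph. Repeated colours are kept here and removed in `palette`.
  colours : List V → List ℕ
  colours []       = []
  colours (x ∷ xs) = map (colour x) xs ++ colours xs

  palette : List V → List ℕ
  palette xs = deduplicate ℕ._≟_ (colours xs)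

  colour∈colours : ∀ {u v xs} → u ∈ xs → v ∈ xs → u ≢ v → colour u v ∈ colours xs
  colour∈colours (here refl) (here refl) u≢v = ⊥-elim (u≢v refl)
  colour∈colours (here refl) (there v∈)  u≢v = ∈-++⁺ˡ (∈-map⁺ (colour _) v∈)
  colour∈colours {u} {v} (there u∈) (here refl) u≢v =
    ∈-++⁺ˡ (subst (_∈ map (colour v) _) (colour-sym v u) (∈-map⁺ (colour v) u∈))
  colour∈colours {xs = x ∷ xs} (there u∈) (there v∈) u≢v =
    ∈-++⁺ʳ (map (colour x) xs) (colour∈colours u∈ v∈ u≢v)

  ∈-colours⁻ : ∀ {k xs} → Unique xs → k ∈ colours xs →
    ∃₂ λ u v → u ∈ xs × v ∈ xs × u ≢ v × k ≡ colour u v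
  ∈-colours⁻ {xs = x ∷ xs} (x∉ ∷ u) k∈ with ∈-++⁻ (map (colour x) xs) k∈
  ... | inj₁ k∈map =
    let v , v∈ , eq = ∈-map⁻ (colour x) k∈map
    in x , v , here refl , there v∈ , All.lookup x∉ v∈ , eq
  ... | inj₂ k∈xs =
    let a , b , a∈ , b∈ , a≢b , eq = ∈-colours⁻ u k∈xs
    in a , b , there a∈ , there b∈ , a≢b , eq

  -- On l vertices there are l (l - 1) / 2 entries. The factor 2 avoids the division; the linear
  -- term is given away, which the final count can afford.
  2*length-colours-≤ : ∀ xs → 2 * length (colours xs) ≤ length xs * length xs
  2*length-colours-≤ []       = z≤n
  2*length-colours-≤ (x ∷ xs) = begin
    2 * length (map (colour x) xs ++ colours xs)
      ≡⟨ cong (2 *_) (trans (length-++ (map (colour x) xs)) (cong (_+ q) (length-map (colour x) xs))) ⟩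
    2 * (l + q)           ≡⟨ *-distribˡ-+ 2 l q ⟩
    2 * l + 2 * q         ≤⟨ +-monoʳ-≤ (2 * l) (2*length-colours-≤ xs) ⟩
    2 * l + l * l         ≤⟨ n≤1+n _ ⟩
    suc (2 * l + l * l)   ≡⟨ square l ⟩
    suc l * suc l         ∎
    where
    open ≤-Reasoning
    l = length xs
    q = length (colours xs)
    square : ∀ l → suc (2 * l + l * l) ≡ suc l * suc l
    square = solve-∀

  -- For `x` outside `R`, these are the colours saturated at `x` in the graph on `x ∷ R`: all their
  -- edges meet `x`, so they are exactly what deleting `x` loses.
  newColours : List V → V → List ℕ
  newColours R x = difference ℕ._≟_ (deduplicate ℕ._≟_ (map (colour x) R)) (colours R)

  newColours-unique : ∀ R x → Unique (newColours R x)
  newColours-unique R x = difference-unique ℕ._≟_ (colours R) (deduplicate-! ℕ._≟_ (map (colour x) R))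

  ∈-newColours⁻ : ∀ {k R x} → k ∈ newColours R x → (∃ λ v → v ∈ R × k ≡ colour x v) × k ∉ colours R
  ∈-newColours⁻ {R = R} {x} k∈ with ∈-difference⁻ ℕ._≟_ {xs = deduplicate ℕ._≟_ (map (colour x) R)} k∈
  ... | k∈ , k∉ = ∈-map⁻ (colour x) (∈-deduplicate⁻ ℕ._≟_ (map (colour x) R) k∈) , k∉

  length-newColours-≤ : ∀ R x → length (newColours R x) ≤ length R
  length-newColours-≤ R x = subst (length (newColours R x) ≤_) (length-map (colour x) R)
    (unique-⊆⇒length-≤ (newColours-unique R x)
      λ k∈ → ∈-deduplicate⁻ ℕ._≟_ (map (colour x) R) (proj₁ (∈-difference⁻ ℕ._≟_ k∈)))

  -- Edges are sorted by where their ends lie. A colour between `T` and `R` either occurs inside `R`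
  -- already or is new at its end in `T`.
  length-palette-≤ : ∀ {L T R} → Unique L → L ⊆ T ++ R →
    length (palette L) ≤ length (concatMap (newColours R) T) + (length (colours T) + length (palette R))
  length-palette-≤ {L} {T} {R} uL L⊆ = begin
    length (palette L)                                                  ≤⟨ unique-⊆⇒length-≤ (deduplicate-! ℕ._≟_ _) cover ⟩
    length (new ++ colours T ++ palette R)                              ≡⟨ length-++ new ⟩
    length new + length (colours T ++ palette R)                        ≡⟨ cong (length new +_) (length-++ (colours T)) ⟩
    length new + (length (colours T) + length (palette R))              ∎
    where
    open ≤-Reasoning
    new = concatMap (newColours R) T
    inPalette : ∀ {k} → k ∈ colours R → k ∈ new ++ colours T ++ palette R
    inPalette k∈ = ∈-++⁺ʳ new (∈-++⁺ʳ (colours T) (∈-deduplicate⁺ ℕ._≟_ k∈))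
    across : ∀ {u v} → u ∈ T → v ∈ R → colour u v ∈ new ++ colours T ++ palette R
    across {u} {v} u∈ v∈ with colour u v ∈? colours R
    ... | yes k∈ = inPalette k∈
    ... | no  k∉ = ∈-++⁺ˡ (∈-concatMap⁺ (newColours R) (Any.map
            (λ { refl → ∈-difference⁺ ℕ._≟_ (∈-deduplicate⁺ ℕ._≟_ (∈-map⁺ (colour u) v∈)) k∉ }) u∈))
    cover : palette L ⊆ new ++ colours T ++ palette R
    cover k∈ with ∈-colours⁻ uL (∈-deduplicate⁻ ℕ._≟_ _ k∈)
    ... | u , v , u∈ , v∈ , u≢v , refl with ∈-++⁻ T (L⊆ u∈) | ∈-++⁻ T (L⊆ v∈)
    ...   | inj₁ u∈T | inj₁ v∈T = ∈-++⁺ʳ new (∈-++⁺ˡ (colour∈colours u∈T v∈T u≢v))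
    ...   | inj₁ u∈T | inj₂ v∈R = across u∈T v∈R
    ...   | inj₂ u∈R | inj₁ v∈T = subst (_∈ new ++ colours T ++ palette R) (colour-sym v u) (across v∈T u∈R)
    ...   | inj₂ u∈R | inj₂ v∈R = inPalette (colour∈colours u∈R v∈R u≢v)

  length-palette-remove : ∀ {L x R} → Unique L → L ⊆ x ∷ R →
    length (palette L) ≤ length (newColours R x) + length (palette R)
  length-palette-remove {L} {x} {R} uL L⊆ = ≤-trans (length-palette-≤ {T = x ∷ []} uL L⊆)
    (≤-reflexive (cong (_+ length (palette R))
      (trans (length-++ (newColours R x)) (+-identityʳ _))))

  -- Rainbow triangles and Gallai's bound.

  Triple : Set
  Triple = V × V × V

  corners : Triple → List V
  corners (x , y , z) = x ∷ y ∷ z ∷ []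

  -- The order of the three colours is that of `triangleEdges`, so this unfolds to the same
  -- condition as `Rainbow` there.
  IsRainbow : Triple → Set
  IsRainbow (x , y , z) = Unique (colour x y ∷ colour y z ∷ colour x z ∷ [])

  RainbowTriangle : List V → Set
  RainbowTriangle L = ∃ λ t → (IsRainbow t × Unique (corners t)) × corners t ⊆ L

  corners-⊆ : ∀ {x y z L} → x ∈ L → y ∈ L → z ∈ L → corners (x , y , z) ⊆ L
  corners-⊆ x∈ y∈ z∈ (here refl)                 = x∈
  corners-⊆ x∈ y∈ z∈ (there (here refl))         = y∈
  corners-⊆ x∈ y∈ z∈ (there (there (here refl))) = z∈

  triangle-mono : ∀ {L M} → L ⊆ M → RainbowTriangle L → RainbowTriangle M
  triangle-mono L⊆M (t , good , t⊆) = t , good , L⊆M ∘ t⊆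

  -- The colours of xy and xz are distinct and new to R, whereas that of yz occurs in R.
  rainbow-at : ∀ {R x} S → x ∉ R → 2 + length S ≤ length (newColours R x) → RainbowTriangle (x ∷ (R ∖ S))
  rainbow-at {R} {x} S x∉R 2+S≤
    -- Colours are forbidden instead of vertices: each vertex of `S` rules out one colour at `x`,
    -- and an edge from `x` whose colour survives cannot end in `S`.
    with two-outside ℕ._≟_ (map (colour x) S) (newColours-unique R x)
           (subst (λ s → 2 + s ≤ _) (sym (length-map (colour x) S)) 2+S≤)
  ... | a , b , a≢b , (a∈ , a∉S) , (b∈ , b∉S) with ∈-newColours⁻ {R = R} a∈ | ∈-newColours⁻ {R = R} b∈
  ... | (y , y∈R , refl) , a∉R | (z , z∈R , refl) , b∉R =
    (x , y , z) ,
    ( ((λ eq → a∉R (subst (_∈ colours R) (sym eq) yz∈)) ∷ a≢b ∷ [])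
      ∷ ((λ eq → b∉R (subst (_∈ colours R) eq yz∈)) ∷ [])
      ∷ [] ∷ []
    , ((λ { refl → x∉R y∈R }) ∷ (λ { refl → x∉R z∈R }) ∷ [])
      ∷ (y≢z ∷ [])
      ∷ [] ∷ []) ,
    corners-⊆ (here refl)
      (there (∈-difference⁺ _≟_ y∈R (λ y∈S → a∉S (∈-map⁺ (colour x) y∈S))))
      (there (∈-difference⁺ _≟_ z∈R (λ z∈S → b∉S (∈-map⁺ (colour x) z∈S))))
    where
    y≢z : y ≢ z
    y≢z refl = a≢b refl
    yz∈ : colour y z ∈ colours R
    yz∈ = colour∈colours y∈R z∈R y≢z

  gallai : ∀ {x xs} → Unique (x ∷ xs) → length xs < length (palette (x ∷ xs)) → RainbowTriangle (x ∷ xs)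
  gallai {x} {xs} u@(_ ∷ uxs) xs< with 2 ≤? length (newColours xs x)
  ... | yes 2≤ = triangle-mono (λ { (here eq) → here eq ; (there v∈) → there (proj₁ (∈-difference⁻ _≟_ v∈)) })
                   (rainbow-at [] (Unique.Unique[x∷xs]⇒x∉xs u) 2≤)
  -- A single vertex spans no colour, so the surplus cannot persist down to this case.
  gallai {x} {[]} _ () | no _
  gallai {x} {y ∷ ys} u@(_ ∷ uxs) xs< | no 2≰ = triangle-mono there (gallai uxs (≤-pred (begin-strict
    suc (length ys)                                               <⟨ xs< ⟩
    length (palette (x ∷ y ∷ ys))                                 ≤⟨ length-palette-remove u id ⟩
    length (newColours (y ∷ ys) x) + length (palette (y ∷ ys))    ≤⟨ +-monoˡ-≤ _ (≤-pred (≰⇒> 2≰)) ⟩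
    1 + length (palette (y ∷ ys))                                 ∎)))
    where
    open ≤-Reasoning

  -- Packings of disjoint rainbow triangles.

  vertices : List Triple → List V
  vertices = concatMap corners

  data IsPacking : List Triple → Set where
    []  : IsPacking []
    add : ∀ {t ts} → IsRainbow t × Unique (corners t) → Disjoint (corners t) (vertices ts) →
          IsPacking ts → IsPacking (t ∷ ts)

  Packing : List V → ℕ → Set
  Packing L k = ∃ λ ts → IsPacking ts × length ts ≡ k × vertices ts ⊆ L

  vertices-unique : ∀ {ts} → IsPacking ts → Unique (vertices ts)
  vertices-unique []                  = []
  vertices-unique (add (_ , u) t# ps) = Unique.++⁺ u (vertices-unique ps) t#

  length-vertices : ∀ ts → length (vertices ts) ≡ length ts * 3
  length-vertices []       = refl
  length-vertices (t ∷ ts) = cong (3 +_) (length-vertices ts)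

  packing-mono : ∀ {L M k} → L ⊆ M → Packing L k → Packing M k
  packing-mono L⊆M (ts , ps , len , ts⊆) = ts , ps , len , L⊆M ∘ ts⊆

  singleton : ∀ {L} → RainbowTriangle L → Packing L 1
  singleton {L} (t , good , t⊆) = t ∷ [] , add good (λ ()) [] , refl , t⊆

  -- Each exchange below assembles its packing from smaller ones on disjoint vertex sets.
  union : ∀ {A B j k} → Disjoint A B → Packing A j → Packing B k → Packing (A ++ B) (j + k)
  union {A} {B} A#B (ts , ps , refl , ts⊆) (us , qs , refl , us⊆) =
    ts ++ us , go ts ps ts⊆ , length-++ ts , sub
    where
    sub : vertices (ts ++ us) ⊆ A ++ B
    sub v∈ with ∈-++⁻ (vertices ts) (subst (_ ∈_) (concatMap-++ corners ts us) v∈)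
    ... | inj₁ v∈ts = ∈-++⁺ˡ (ts⊆ v∈ts)
    ... | inj₂ v∈us = ∈-++⁺ʳ A (us⊆ v∈us)
    go : ∀ ts → IsPacking ts → vertices ts ⊆ A → IsPacking (ts ++ us)
    go []       []               _   = qs
    go (t ∷ ts) (add good t# ps) ts⊆ = add good t#′ (go ts ps (ts⊆ ∘ ∈-++⁺ʳ (corners t)))
      where
      t#′ : Disjoint (corners t) (vertices (ts ++ us))
      t#′ (v∈t , v∈) with ∈-++⁻ (vertices ts) (subst (_ ∈_) (concatMap-++ corners ts us) v∈)
      ... | inj₁ v∈ts = t# (v∈t , v∈ts)
      ... | inj₂ v∈us = A#B (ts⊆ (∈-++⁺ˡ v∈t) , us⊆ v∈us)

  -- The threshold 5 is 2 plus the 3 corners of the first triangle, which the second must avoid.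
  two-triangles : ∀ {x y R} → x ≢ y → x ∉ R → y ∉ R →
    5 ≤ length (newColours R x) → 5 ≤ length (newColours R y) → Packing (x ∷ y ∷ R) 2
  two-triangles {x} {y} {R} x≢y x∉R y∉R 5≤x 5≤y with rainbow-at [] x∉R (≤-trans (m≤m+n 2 3) 5≤x)
  ... | t , good , t⊆ = packing-mono sub
          (union disj (singleton (t , good , id)) (singleton (rainbow-at (corners t) y∉R 5≤y)))
    where
    t⊆x∷R : corners t ⊆ x ∷ R
    t⊆x∷R v∈ with t⊆ v∈
    ... | here eq   = here eq
    ... | there v∈R = there (proj₁ (∈-difference⁻ _≟_ v∈R))
    disj : Disjoint (corners t) (y ∷ (R ∖ corners t))
    disj (v∈t , here refl) with t⊆x∷R v∈t
    ... | here eq   = x≢y (sym eq)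
    ... | there y∈R = y∉R y∈R
    disj (v∈t , there v∈) = proj₂ (∈-difference⁻ _≟_ {xs = R} v∈) v∈t
    sub : corners t ++ y ∷ (R ∖ corners t) ⊆ x ∷ y ∷ R
    sub v∈ with ∈-++⁻ (corners t) v∈
    ... | inj₂ (here eq)  = there (here eq)
    ... | inj₂ (there v∈) = there (there (proj₁ (∈-difference⁻ _≟_ v∈)))
    ... | inj₁ v∈t with t⊆x∷R v∈t
    ...   | here eq   = here eq
    ...   | there v∈R = there (there v∈R)

  gallai-bound : ∀ {R} → Unique R → 0 < length R → RainbowTriangle R ⊎ length (palette R) < length R
  gallai-bound {x ∷ xs} u _ with length xs <? length (palette (x ∷ xs))
  ... | yes xs< = inj₁ (gallai u xs<)
  ... | no  xs≮ = inj₂ (s≤s (≮⇒≥ xs≮))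

  -- New-colour degrees and crowded triangles.

  degree : List V → V → ℕ
  degree R x = length (newColours R x)

  Crowded : List V → Triple → Set
  Crowded R (x , y , z) =
    (5 ≤ degree R x × 5 ≤ degree R y) ⊎ (5 ≤ degree R x × 5 ≤ degree R z) ⊎ (5 ≤ degree R y × 5 ≤ degree R z)

  crowded? : ∀ R t → Dec (Crowded R t)
  crowded? R (x , y , z) =
    ((5 ≤? degree R x) ×-dec (5 ≤? degree R y)) ⊎-dec
    (((5 ≤? degree R x) ×-dec (5 ≤? degree R z)) ⊎-dec ((5 ≤? degree R y) ×-dec (5 ≤? degree R z)))

  crowded⇒two-triangles : ∀ {R} t → Unique (corners t) → Disjoint (corners t) R → Crowded R t →
    Packing (corners t ++ R) 2
  crowded⇒two-triangles {R} t@(x , y , z) ((x≢y ∷ x≢z ∷ []) ∷ (y≢z ∷ []) ∷ _) t#R = λ where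
      (inj₁ (5≤x , 5≤y))        → at x≢y x∈ y∈ 5≤x 5≤y
      (inj₂ (inj₁ (5≤x , 5≤z))) → at x≢z x∈ z∈ 5≤x 5≤z
      (inj₂ (inj₂ (5≤y , 5≤z))) → at y≢z y∈ z∈ 5≤y 5≤z
    where
    x∈ : x ∈ corners t
    x∈ = here refl
    y∈ : y ∈ corners t
    y∈ = there (here refl)
    z∈ : z ∈ corners t
    z∈ = there (there (here refl))
    at : ∀ {a b} → a ≢ b → a ∈ corners t → b ∈ corners t → 5 ≤ degree R a → 5 ≤ degree R b →
      Packing (corners t ++ R) 2
    at a≢b a∈ b∈ 5≤a 5≤b = packing-mono
      (λ { (here refl) → ∈-++⁺ˡ a∈ ; (there (here refl)) → ∈-++⁺ˡ b∈ ; (there (there v∈)) → ∈-++⁺ʳ (corners t) v∈ })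
      (two-triangles a≢b (λ a∈R → t#R (a∈ , a∈R)) (λ b∈R → t#R (b∈ , b∈R)) 5≤a 5≤b)

  -- The crowded triangle is given up for two triangles on its corners and `R`. The other triangles
  -- stay, being disjoint from both.
  crowded⇒larger-packing : ∀ {R ts} → IsPacking ts → Disjoint (vertices ts) R → Any (Crowded R) ts →
    Packing (vertices ts ++ R) (suc (length ts))
  crowded⇒larger-packing {R} {t ∷ ts} (add (_ , u) t# ps) ts#R (here crowded) =
    packing-mono sub (union disj
      (crowded⇒two-triangles t u (λ (v∈t , v∈R) → ts#R (∈-++⁺ˡ v∈t , v∈R)) crowded)
      (ts , ps , refl , id))
    where
    disj : Disjoint (corners t ++ R) (vertices ts)
    disj (v∈ , v∈ts) with ∈-++⁻ (corners t) v∈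
    ... | inj₁ v∈t = t# (v∈t , v∈ts)
    ... | inj₂ v∈R = ts#R (∈-++⁺ʳ (corners t) v∈ts , v∈R)
    sub : (corners t ++ R) ++ vertices ts ⊆ vertices (t ∷ ts) ++ R
    sub v∈ with ∈-++⁻ (corners t ++ R) v∈
    ... | inj₂ v∈ts = ∈-++⁺ˡ (∈-++⁺ʳ (corners t) v∈ts)
    ... | inj₁ v∈tR with ∈-++⁻ (corners t) v∈tR
    ...   | inj₁ v∈t = ∈-++⁺ˡ {xs = vertices (t ∷ ts)} (∈-++⁺ˡ v∈t)
    ...   | inj₂ v∈R = ∈-++⁺ʳ (vertices (t ∷ ts)) v∈R
  crowded⇒larger-packing {R} {t ∷ ts} (add good t# ps) ts#R (there crowded) =
    union disj (singleton (t , good , id))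
      (crowded⇒larger-packing ps (λ (v∈ts , v∈R) → ts#R (∈-++⁺ʳ (corners t) v∈ts , v∈R)) crowded)
    where
    disj : Disjoint (corners t) (vertices ts ++ R)
    disj (v∈t , v∈) with ∈-++⁻ (vertices ts) v∈
    ... | inj₁ v∈ts = t# (v∈t , v∈ts)
    ... | inj₂ v∈R  = ts#R (∈-++⁺ˡ v∈t , v∈R)

  -- At most one corner reaches degree 5. The other two contribute at most 4 each, which is the 8,
  -- and the exceptional one at most `M`.
  triple-degree-≤ : ∀ {R M} t → 4 ≤ M → All (λ v → degree R v ≤ M) (corners t) → ¬ Crowded R t →
    length (concatMap (newColours R) (corners t)) ≤ M + 8
  triple-degree-≤ {R} {M} (x , y , z) 4≤M (x≤ ∷ y≤ ∷ z≤ ∷ []) ¬crowded = begin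
    length (newColours R x ++ newColours R y ++ newColours R z ++ [])
      ≡⟨ trans (length-++ (newColours R x)) (cong (degree R x +_)
           (trans (length-++ (newColours R y)) (cong (degree R y +_)
             (trans (length-++ (newColours R z)) (+-identityʳ _))))) ⟩
    degree R x + (degree R y + degree R z) ≤⟨ bound ⟩
    M + 8 ∎
    where
    open ≤-Reasoning
    small : ∀ {a} → ¬ 5 ≤ a → a ≤ 4
    small 5≰a = ≤-pred (≰⇒> 5≰a)
    bound : degree R x + (degree R y + degree R z) ≤ M + 8
    bound with 5 ≤? degree R x | 5 ≤? degree R y | 5 ≤? degree R z
    ... | yes 5≤x | yes 5≤y | _       = contradiction (inj₁ (5≤x , 5≤y)) ¬crowded
    ... | yes 5≤x | no _    | yes 5≤z = contradiction (inj₂ (inj₁ (5≤x , 5≤z))) ¬crowded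
    ... | no _    | yes 5≤y | yes 5≤z = contradiction (inj₂ (inj₂ (5≤y , 5≤z))) ¬crowded
    ... | _       | no 5≰y  | no 5≰z  = +-mono-≤ x≤ (+-mono-≤ (small 5≰y) (small 5≰z))
    ... | no 5≰x  | yes _   | no 5≰z  = ≤-trans (+-mono-≤ (small 5≰x) (+-mono-≤ y≤ (small 5≰z))) (≤-reflexive (rotate M))
      where
      rotate : ∀ M → 4 + (M + 4) ≡ M + 8
      rotate = solve-∀
    ... | no 5≰x  | no 5≰y  | yes _   = ≤-trans (+-mono-≤ (small 5≰x) (+-mono-≤ (small 5≰y) z≤)) (≤-reflexive (+-comm 8 M))

  packing-degree-≤ : ∀ {R M} ts → 4 ≤ M → All (λ v → degree R v ≤ M) (vertices ts) → All (¬_ ∘ Crowded R) ts →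
    length (concatMap (newColours R) (vertices ts)) ≤ length ts * (M + 8)
  packing-degree-≤ []       4≤M _  _ = z≤n
  packing-degree-≤ {R} {M} (t ∷ ts) 4≤M ≤M (¬crowded ∷ ¬crowdeds) = begin
    length (concatMap (newColours R) (corners t ++ vertices ts))
      ≡⟨ cong length (concatMap-++ (newColours R) (corners t) (vertices ts)) ⟩
    length (concatMap (newColours R) (corners t) ++ concatMap (newColours R) (vertices ts))
      ≡⟨ length-++ (concatMap (newColours R) (corners t)) ⟩
    length (concatMap (newColours R) (corners t)) + length (concatMap (newColours R) (vertices ts))
      ≤⟨ +-mono-≤ (triple-degree-≤ {R} t 4≤M (++⁻ˡ (corners t) ≤M) ¬crowded)
                  (packing-degree-≤ {R} ts 4≤M (++⁻ʳ (corners t) ≤M) ¬crowdeds) ⟩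
    M + 8 + length ts * (M + 8) ∎
    where open ≤-Reasoning

  -- The induction on the number of triangles.

  -- The binomial coefficient stands on the right of the inequality to keep truncated subtraction
  -- out of the induction.
  PacksAt : ℕ → Set
  PacksAt k = ∀ L → Unique L → 9 * k + 8 ≤ length L →
    k * length L < length (palette L) + suc k C 2 → Packing L k

  length-remove : ∀ {L x} → Unique L → x ∈ L → length L ≡ suc (length (L ∖ (x ∷ [])))
  length-remove {L} {x} uL x∈L = ≤-antisym
    (unique-⊆⇒length-≤ uL (⊆-difference _≟_ L (x ∷ [])))
    (unique-⊆⇒length-≤ (∉⇒unique-∷ (λ x∈ → proj₂ (∈-difference⁻ _≟_ {xs = L} x∈) (here refl))
                          (difference-unique _≟_ (x ∷ []) uL))
      λ { (here refl) → x∈L ; (there v∈) → proj₁ (∈-difference⁻ _≟_ v∈) })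

  -- Deleting a vertex of an n-vertex graph destroys at most n − 1 colours, exactly what the
  -- bound for suc k exceeds the bound for k by.
  packing-avoiding : ∀ {k L x} → PacksAt k → Unique L → 9 * suc k + 8 ≤ length L →
    suc k * length L < length (palette L) + suc (suc k) C 2 → x ∈ L → Packing (L ∖ (x ∷ [])) k
  packing-avoiding {k} {L} {x} packs uL large many x∈L =
    packs L′ (difference-unique _≟_ (x ∷ []) uL)
      -- The required size drops by 9 while one vertex is lost, which leaves 8 to spare.
      (≤-pred (≤-trans (m≤n+m (suc (9 * k + 8)) 8)
        (subst₂ _≤_ (shift k) (length-remove uL x∈L) large)))
      (+-cancelˡ-≤ (suc k + l) _ _ (begin
        suc k + l + suc (k * l)            ≡⟨ split k l ⟩
        suc (suc k * suc l)                ≡⟨ cong (λ n → suc (suc k * n)) (length-remove uL x∈L) ⟨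
        suc (suc k * length L)             ≤⟨ many ⟩
        length (palette L) + suc (suc k) C 2
          ≤⟨ +-mono-≤ (≤-trans (length-palette-remove uL (⊆-difference _≟_ L (x ∷ [])))
                               (+-monoˡ-≤ _ (length-newColours-≤ L′ x)))
                      (≤-reflexive (pascal k)) ⟩
        l + length (palette L′) + (suc k + suc k C 2)
          ≡⟨ regroup k l _ _ ⟩
        suc k + l + (length (palette L′) + suc k C 2) ∎))
    where
    open ≤-Reasoning
    L′ = L ∖ (x ∷ [])
    l = length L′
    shift : ∀ k → 9 * suc k + 8 ≡ 8 + suc (9 * k + 8)
    shift = solve-∀
    split : ∀ k l → suc k + l + suc (k * l) ≡ suc (suc k * suc l)
    split = solve-∀
    regroup : ∀ k l c t → l + c + (suc k + t) ≡ suc k + l + (c + t)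
    regroup = solve-∀

  -- Two kinds of packing are in play: `ts` fixes the split into `T` and `R`, while `avoiding`
  -- supplies unrelated packings that miss one chosen vertex.
  larger-packing : ∀ {k L ts} → Unique L → 9 * suc k + 8 ≤ length L →
    suc k * length L < length (palette L) + suc (suc k) C 2 →
    (∀ {x} → x ∈ L → Packing (L ∖ (x ∷ [])) k) →
    IsPacking ts → length ts ≡ k → vertices ts ⊆ L → Packing L (suc k)
  larger-packing {k} {L} {ts} uL large many avoiding ps refl T⊆L =
    decide (any? (λ x → 3 * k + 2 ≤? degree R x) T) (any? (crowded? R) ts) (gallai-bound uR R-nonempty)
    where
    open ≤-Reasoning
    T = vertices ts
    R = L ∖ T

    R⊆L : R ⊆ L
    R⊆L = proj₁ ∘ ∈-difference⁻ _≟_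
    T#R : Disjoint T R
    T#R (v∈T , v∈R) = proj₂ (∈-difference⁻ _≟_ {xs = L} v∈R) v∈T
    uR : Unique R
    uR = difference-unique _≟_ T uL
    T++R⊆L : T ++ R ⊆ L
    T++R⊆L v∈ with ∈-++⁻ T v∈
    ... | inj₁ v∈T = T⊆L v∈T
    ... | inj₂ v∈R = R⊆L v∈R

    length-T++R : length (T ++ R) ≡ k * 3 + length R
    length-T++R = trans (length-++ T) (cong (_+ length R) (length-vertices ts))

    upper : k * 3 + length R ≤ length L
    upper = subst (_≤ length L) length-T++R
      (unique-⊆⇒length-≤ (Unique.++⁺ (vertices-unique ps) uR T#R) T++R⊆L)

    -- The strict bound `length (palette R) < length R` from `gallai-bound` fails for an empty list.
    -- Here at least 6 k + 17 vertices remain.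
    R-nonempty : 0 < length R
    R-nonempty = +-cancelˡ-≤ (k * 3) 1 (length R) (begin
      k * 3 + 1          ≤⟨ m≤m+n _ (6 * k + 16) ⟩
      k * 3 + 1 + (6 * k + 16) ≡⟨ lower k ⟩
      9 * suc k + 8      ≤⟨ large ⟩
      length L           ≤⟨ unique-⊆⇒length-≤ uL (⊆-difference _≟_ L T) ⟩
      length (T ++ R)    ≡⟨ length-T++R ⟩
      k * 3 + length R   ∎)
      where
      lower : ∀ k → k * 3 + 1 + (6 * k + 16) ≡ 9 * suc k + 8
      lower = solve-∀

    -- The packing of `L` without `x` may meet `R` anywhere, but its 3 k vertices block at most 3 k
    -- of the new colours at `x`. Two are left for a triangle at `x`, hence the threshold
    -- `3 * k + 2`.
    add-at : ∀ {x} → x ∈ T → 3 * k + 2 ≤ degree R x → Packing (L ∖ (x ∷ [])) k → Packing L (suc k)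
    add-at {x} x∈T big (us , qs , len , us⊆) = packing-mono sub (union disj
        (singleton (rainbow-at S (λ x∈R → T#R (x∈T , x∈R)) (begin
          2 + length S    ≡⟨ cong (2 +_) (trans (length-vertices us) (cong (_* 3) len)) ⟩
          2 + k * 3       ≡⟨ swap k ⟩
          3 * k + 2       ≤⟨ big ⟩
          degree R x      ∎)))
        (us , qs , len , id))
      where
      S = vertices us
      swap : ∀ k → 2 + k * 3 ≡ 3 * k + 2
      swap = solve-∀
      disj : Disjoint (x ∷ (R ∖ S)) S
      disj (here refl , x∈S) = proj₂ (∈-difference⁻ _≟_ {xs = L} (us⊆ x∈S)) (here refl)
      disj (there v∈ , v∈S)  = proj₂ (∈-difference⁻ _≟_ {xs = R} v∈) v∈S
      sub : (x ∷ (R ∖ S)) ++ S ⊆ L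
      sub (here refl) = T⊆L x∈T
      sub (there v∈) with ∈-++⁻ (R ∖ S) v∈
      ... | inj₁ v∈R∖S = R⊆L (proj₁ (∈-difference⁻ _≟_ v∈R∖S))
      ... | inj₂ v∈S   = proj₁ (∈-difference⁻ _≟_ (us⊆ v∈S))

    too-few : All (λ x → ¬ 3 * k + 2 ≤ degree R x) T → All (¬_ ∘ Crowded R) ts →
      length (palette R) < length R → ⊥
    too-few small ¬crowded cR< = colour-count-contradiction large
      many (length-palette-≤ {T = T} {R} uL (⊆-difference _≟_ L T))
      (packing-degree-≤ {R} ts (m≤n+m 4 (3 * k)) (All.map degree-≤ small) ¬crowded)
      (subst (λ s → 2 * length (colours T) ≤ s * s) (length-vertices ts) (2*length-colours-≤ T))
      cR< upper
      where
      -- Missing the threshold gives 3 k + 1 at most. The weaker `3 * k + 4` is at least 4 for every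
      -- k, including 0, as `packing-degree-≤` asks of its `M`.
      degree-≤ : ∀ {d} → ¬ 3 * k + 2 ≤ d → d ≤ 3 * k + 4
      degree-≤ 3k+2≰d = ≤-trans (<⇒≤ (≰⇒> 3k+2≰d)) (+-monoʳ-≤ (3 * k) (m≤m+n 2 2))

    via-rainbow-rest : RainbowTriangle R → Packing L (suc k)
    via-rainbow-rest Δ = packing-mono sub
      (union (λ (v∈R , v∈T) → T#R (v∈T , v∈R)) (singleton Δ) (ts , ps , refl , id))
      where
      sub : R ++ T ⊆ L
      sub v∈ with ∈-++⁻ R v∈
      ... | inj₁ v∈R = R⊆L v∈R
      ... | inj₂ v∈T = T⊆L v∈T

    decide : Dec (Any (λ x → 3 * k + 2 ≤ degree R x) T) → Dec (Any (Crowded R) ts) →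
      RainbowTriangle R ⊎ length (palette R) < length R → Packing L (suc k)
    decide (yes big) _           _          = let _ , x∈T , 3k+2≤ = find big in add-at x∈T 3k+2≤ (avoiding (T⊆L x∈T))
    decide (no _)    (yes crowd) _          = packing-mono T++R⊆L (crowded⇒larger-packing ps T#R crowd)
    decide (no _)    (no _)      (inj₁ Δ)   = via-rainbow-rest Δ
    decide (no ¬big) (no ¬crowd) (inj₂ cR<) = ⊥-elim (too-few (¬Any⇒All¬ T ¬big) (¬Any⇒All¬ ts ¬crowd) cR<)

  packs : ∀ k → PacksAt k
  packs zero    L _ _ _ = [] , [] , refl , λ ()
  packs (suc k) [] _ () _
  packs (suc k) L@(v ∷ _) uL large many =
    -- Any vertex may be deleted to obtain the initial packing; `v` itself then ends up in `R`.
    let ts , ps , len , ts⊆ = avoiding (here refl)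
    in larger-packing uL large many avoiding ps len (λ v∈ → proj₁ (∈-difference⁻ _≟_ {ys = v ∷ []} (ts⊆ v∈)))
    where
    avoiding : ∀ {x} → x ∈ L → Packing (L ∖ (x ∷ [])) k
    avoiding = packing-avoiding (packs k) uL large many

  -- From packings to indexed families of triangles in the graph.

  lookup-vertices : ∀ {v} ts i → v ∈ corners (lookup ts i) → v ∈ vertices ts
  lookup-vertices (t ∷ ts) zero    v∈ = ∈-++⁺ˡ v∈
  lookup-vertices (t ∷ ts) (suc i) v∈ = ∈-++⁺ʳ (corners t) (lookup-vertices ts i v∈)

  lookup-rainbow : ∀ {ts} → IsPacking ts → ∀ i → IsRainbow (lookup ts i) × Unique (corners (lookup ts i))
  lookup-rainbow (add good _ _) zero    = good
  lookup-rainbow (add _ _ ps)   (suc i) = lookup-rainbow ps i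

  lookup-disjoint : ∀ {ts} → IsPacking ts → ∀ i j → i ≢ j →
    Disjoint (corners (lookup ts i)) (corners (lookup ts j))
  lookup-disjoint               (add _ _ _)  zero    zero    i≢j _         = i≢j refl
  lookup-disjoint {ts = _ ∷ ts} (add _ t# _) zero    (suc j) _   (v∈ , w∈) = t# (v∈ , lookup-vertices ts j w∈)
  lookup-disjoint {ts = _ ∷ ts} (add _ t# _) (suc i) zero    _   (v∈ , w∈) = t# (w∈ , lookup-vertices ts i v∈)
  lookup-disjoint               (add _ _ ps) (suc i) (suc j) i≢j v∈w∈      = lookup-disjoint ps i j (i≢j ∘ cong suc) v∈w∈

module _ {n : ℕ} (G : EdgeColouredGraph n) (complete : Complete G) where
  open EdgeColouredGraph G
  open Colouring Fin._≟_ colour colour-sym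

  -- A listed edge has ends `u < v`, hence distinct ones. As `c G` is bounded from below, this
  -- direction is the one that carries the bound over to `palette`.
  c≤length-palette : c G ≤ length (palette (allFin n))
  c≤length-palette = unique-⊆⇒length-≤ (deduplicate-! ℕ._≟_ _) λ k∈ →
    let (u , v) , e∈ , eq = ∈-map⁻ (uncurry colour) (∈-deduplicate⁻ ℕ._≟_ (map (uncurry colour) edges) k∈)
        _ , u<v = ∈-filter⁻ (λ e → proj₁ e Fin.<? proj₂ e) {xs = cartesianProduct (allFin n) (allFin n)}
                    (proj₁ (∈-filter⁻ (λ e → adj? (proj₁ e) (proj₂ e)) e∈))
    in ∈-deduplicate⁺ ℕ._≟_ (subst (_∈ colours (allFin n)) (sym eq)
         (colour∈colours (∈-allFin u) (∈-allFin v) (Fin.<⇒≢ u<v)))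

  corner : Triple → Fin 3 → Fin n
  corner t = lookup (corners t)

  -- Completeness of the graph enters here: distinct corners are adjacent.
  triangle : ∀ t → Unique (corners t) → Triangle G
  triangle t u = record { vertex = corner t ; adjacent = λ p q p≢q → complete _ _ (p≢q ∘ unique⇒lookup-injective u p q) }

  packing⇒properK₃s : ∀ {m} → Packing (allFin n) m → ContainsPropermK₃ G m
  packing⇒properK₃s (ts , ps , refl , _) =
    (λ i → triangle (lookup ts i) (proj₂ (lookup-rainbow ps i))) ,
    (λ i → proj₁ (lookup-rainbow ps i)) ,
    (λ i j i≢j p q eq → lookup-disjoint ps i j i≢j
      (subst (_∈ _) eq (∈-lookup p) , ∈-lookup q))

theorem1p6 : (m n : ℕ) → m ≥ 1 → n ≥ 9 * m + 8 →
    (G : EdgeColouredGraph n) → Complete G →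
    c G > m * n ∸ ((m + 1) C 2) →
    ContainsPropermK₃ G m
theorem1p6 m n _ large G complete many = packing⇒properK₃s G complete
  (packs m (allFin n) (Unique.allFin⁺ n) (subst (9 * m + 8 ≤_) (sym length-allFin) large) (begin-strict
    m * length (allFin n)                        ≡⟨ cong (m *_) length-allFin ⟩
    -- This inequality holds whether or not the subtraction in the hypothesis truncates.
    m * n                                        ≤⟨ m≤n+m∸n (m * n) ((m + 1) C 2) ⟩
    (m + 1) C 2 + (m * n ∸ (m + 1) C 2)          <⟨ +-monoʳ-< ((m + 1) C 2) many ⟩
    (m + 1) C 2 + c G                            ≤⟨ +-monoʳ-≤ ((m + 1) C 2) (c≤length-palette G complete) ⟩
    (m + 1) C 2 + length (palette (allFin n))    ≡⟨ +-comm ((m + 1) C 2) _ ⟩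
    length (palette (allFin n)) + (m + 1) C 2    ≡⟨ cong (λ s → length (palette (allFin n)) + s C 2) (+-comm m 1) ⟩
    length (palette (allFin n)) + suc m C 2      ∎))
  where
  open ≤-Reasoning
  open EdgeColouredGraph G
  open Colouring Fin._≟_ colour colour-sym
  length-allFin : length (allFin n) ≡ n
  length-allFin = length-tabulate id
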